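{- For any $n \geq 0$, each equivalence class of $\mathfrak{S}_n/_{\equiv_{\mathrm{B}}}$ is an interval of the permutohedron, that is, an interval of the poset $(\mathfrak{S}_n, \leq_{\mathrm{P}})$.
   Context: $A = \{a_1 < a_2 < \cdots\}$ is a totally ordered infinite alphabet and $A^*$ is the free monoid of words on $A$. A congruence on $A^*$ is an equivalence relation compatible with concatenation. The Baxter congruence $\equiv_{\mathrm{B}}$ is the smallest congruence on $A^*$ such that, for all words $u, v \in A^*$ and letters $a,b,c,d \in A$: $\; c\,u\,a d\,v\,b \equiv_{\mathrm{B}} c\,u\,d a\,v\,b$ whenever $a \leq b < c \leq d$, and $\; b\,u\,d a\,v\,c \equiv_{\mathrm{B}} b\,u\,a d\,v\,c$ whenever $a < b \leq c < d$. $\mathfrak{S}_n$ is the set of permutations of size $n$, a permutation of size $n$ being seen as a word of length $n$ without repetition on the first $n$ letters of $A$ (identified with $1,\dots,n$); $\equiv_{\mathrm{B}}$ thus restricts to an equivalence relation on $\mathfrak{S}_n$. The (right) permutohedron order $\leq_{\mathrm{P}}$ is the partial order on $\mathfrak{S}_n$ in which $\sigma$ is covered by $\nu$ if and only if $\sigma = u\,a b\,v$ and $\nu = u\,b a\,v$ for some words $u, v$ and letters $a < b$. It is a lattice. -}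

module Defs where

open import Level using (Level; _⊔_)
open import Data.Nat using (ℕ; _≤_; _<_)
open import Data.List using (List; []; _∷_; _++_; [_]; length)
open import Data.List.Relation.Unary.All using (All)
open import Data.List.Relation.Unary.Unique.Propositional using (Unique)
open import Data.Product using (_×_; ∃₂)
open import Data.Refinement using (Refinement; value)
open import Relation.Binary.Core using (Rel)
open import Relation.Binary.Construct.Closure.ReflexiveTransitive using (Star)
open import Relation.Binary.PropositionalEquality using (_≡_)
open import Relation.Unary using (Pred; _≐_)

-- The alphabet {a₁ < a₂ < ⋯} is ℕ with its usual order; the letter aᵢ₊₁ is
-- the number i, so that the first n letters are the numbers below n.
Letter : Set
Letter = ℕ

Word : Set
Word = List Letter

infix 4 _≡B_ _⋖_ _≤P_

-- Being inductive, this is the smallest relation closed under its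
-- constructors: the first four say that it is a congruence on the free monoid.
data _≡B_ : Rel Word Level.zero where
  refl    : ∀ {x} → x ≡B x
  sym     : ∀ {x y} → x ≡B y → y ≡B x
  trans   : ∀ {x y z} → x ≡B y → y ≡B z → x ≡B z
  ++-cong : ∀ {x x′ y y′} → x ≡B x′ → y ≡B y′ → x ++ y ≡B x′ ++ y′
  cuadvb  : ∀ (u v : Word) {a b c d : Letter} → a ≤ b → b < c → c ≤ d →
            c ∷ u ++ a ∷ d ∷ v ++ [ b ] ≡B c ∷ u ++ d ∷ a ∷ v ++ [ b ]
  budavc  : ∀ (u v : Word) {a b c d : Letter} → a < b → b ≤ c → c < d →
            b ∷ u ++ d ∷ a ∷ v ++ [ c ] ≡B b ∷ u ++ a ∷ d ∷ v ++ [ c ]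

record IsPermutation (n : ℕ) (w : Word) : Set where
  field
    length≡n     : length w ≡ n
    noRepetition : Unique w
    firstLetters : All (_< n) w

-- The proof component of a refinement type is irrelevant, so two elements of
-- 𝔖 n are equal as soon as their underlying words are.
𝔖 : ℕ → Set
𝔖 n = Refinement Word (IsPermutation n)

data _⋖_ {n : ℕ} (σ ν : 𝔖 n) : Set where
  swap : ∀ (u v : Word) {a b : Letter} → a < b →
         value σ ≡ u ++ a ∷ b ∷ v → value ν ≡ u ++ b ∷ a ∷ v → σ ⋖ ν

-- A partial order on a finite set is the reflexive transitive closure of its
-- covering relation.
_≤P_ : {n : ℕ} → Rel (𝔖 n) Level.zero
_≤P_ = Star _⋖_

BaxterClass : {n : ℕ} → 𝔖 n → Pred (𝔖 n) Level.zero
BaxterClass σ τ = value σ ≡B value τ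

IsInterval : {a ℓ p : Level} {X : Set a} → Rel X ℓ → Pred X p → Set (a ⊔ ℓ ⊔ p)
IsInterval _≼_ P = ∃₂ λ x y → P ≐ (λ z → x ≼ z × z ≼ y)

{-# OPTIONS --safe #-}

-- A pair of letters of a permutation w is *straddled* when some letter strictly
-- between them (in value) precedes both of them in w and another one follows
-- both.  Baxter moves are exactly the exchanges of adjacent straddled letters,
-- and they do not change which pairs are straddled.  Hence the class of w
-- consists of the permutations that order all unstraddled pairs of w as w does:
-- conversely, if τ is such a permutation, then bubble sort from τ to w only uses
-- Baxter moves.  Since the permutohedron order is inclusion of inversion sets,
-- this description makes classes convex.  A class has a least element, namely
-- any member w without straddled descent: if some pair d … a of w with a < d
-- were not inverted in another member z, take such a pair at minimal distance in
-- w.  It is straddled and, by minimality, no letter standing between d and a has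
-- its value between a and d, so one of the adjacent pairs from d to a is a
-- descent from ≥ d to ≤ a; its letters are straddled by the letters that
-- straddle a and d.  Greatest elements are obtained by reversing the alphabet.

module Submission where

open import Defs
open import Data.Irrelevant using ([_])
open import Data.List using ([]; _∷_; _++_; _∷ʳ_; length; filter)
open import Data.List.Membership.Propositional using (_∈_; find; lose)
open import Data.List.Membership.Propositional.Properties
  using (∈-++⁺ʳ; ∈-∃++)
open import Data.List.Properties
  using (++-assoc; ++-identityʳ; ∷ʳ-++; ∷-injective; length-++; filter-accept; filter-reject)
open import Data.List.Relation.Binary.Permutation.Propositional
  using (_↭_; swap; ↭-refl; ↭-sym; ↭-trans; ↭⇒↭ₛ)
open import Data.List.Relation.Binary.Permutation.Propositional.Properties
  using (++⁺; ++⁺ˡ; ∈-resp-↭; All-resp-↭; ↭-length; ↭-empty-inv; drop-mid; filter-↭)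
import Data.List.Relation.Binary.Permutation.Setoid.Properties as Permutationₛ
open import Data.List.Relation.Unary.All as All using (All; []; _∷_)
open import Data.List.Relation.Unary.All.Properties as All using (¬Any⇒All¬)
open import Data.List.Relation.Unary.AllPairs using ([]; _∷_)
open import Data.List.Relation.Unary.Any as Any using (Any; here; there; any?)
open import Data.List.Relation.Unary.Any.Properties as Any using ()
open import Data.List.Relation.Unary.Unique.Propositional using (Unique)
open import Data.Nat using (ℕ; suc; _+_; _<_; _>_; _≤_; s≤s; _≤?_)
open import Data.Nat.Induction using (<-wellFounded)
open import Data.Nat.Properties as ℕ using (_≟_; _<?_)
open import Data.List.Relation.Unary.Unique.DecPropositional _≟_ using (unique?)
open import Data.Product using (_×_; _,_; ∃; ∃₂)
open import Data.Refinement using (value; _,_)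
open import Data.Sum as Sum using (_⊎_; inj₁; inj₂)
open import Function using (case_of_; flip; _∘_)
open import Induction.WellFounded using (Acc; acc)
import Level
open import Relation.Binary.Construct.Closure.ReflexiveTransitive as Star
  using (Star; ε; _◅_; _◅◅_)
import Relation.Binary.Construct.Flip.EqAndOrd as Flip
open import Relation.Binary.Core using (Rel)
open import Relation.Binary.Definitions using (Transitive; tri<; tri≈; tri>)
open import Relation.Binary.PropositionalEquality as ≡
  using (_≡_; refl; cong; subst; subst₂; setoid)
open import Relation.Binary.Structures using (IsStrictTotalOrder)
open import Relation.Nullary using (¬_; Dec; yes; no; contradiction; recompute)
open import Relation.Nullary.Decidable using (_×-dec_; _⊎-dec_)
open import Relation.Unary using (Pred; Decidable)

private
  variable
    a b c d x y z : Letter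
    u v w w′ : Word

-- Betweenness of values

Between : Letter → Letter → Letter → Set
Between x b y = (x < b × b < y) ⊎ (y < b × b < x)

between? : ∀ x b y → Dec (Between x b y)
between? x b y = (x <? b ×-dec b <? y) ⊎-dec (y <? b ×-dec b <? x)

between-sym : Between x b y → Between y b x
between-sym = Sum.swap

¬between-same : ¬ Between x b x
¬between-same (inj₁ (p , q)) = ℕ.<-asym p q
¬between-same (inj₂ (p , q)) = ℕ.<-asym p q

between-narrowˡ : Between x b y → Between x c b → Between x c y
between-narrowˡ (inj₁ (p , q)) (inj₁ (r , s)) = inj₁ (r , ℕ.<-trans s q)
between-narrowˡ (inj₁ (p , q)) (inj₂ (r , s)) = contradiction (ℕ.<-trans r s) (ℕ.<-asym p)
between-narrowˡ (inj₂ (p , q)) (inj₁ (r , s)) = contradiction (ℕ.<-trans r s) (ℕ.<-asym q)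
between-narrowˡ (inj₂ (p , q)) (inj₂ (r , s)) = inj₂ (ℕ.<-trans p r , s)

between-narrowʳ : Between x b y → Between b c y → Between x c y
between-narrowʳ p q = between-sym (between-narrowˡ (between-sym p) (between-sym q))

-- Order of occurrence of the letters in a word

data Before : Word → Letter → Letter → Set where
  here  : y ∈ w → Before (x ∷ w) x y
  there : Before w x y → Before (z ∷ w) x y

before-∈ˡ : Before w x y → x ∈ w
before-∈ˡ (here _)  = here refl
before-∈ˡ (there p) = there (before-∈ˡ p)

before-∈ʳ : Before w x y → y ∈ w
before-∈ʳ (here p)  = there p
before-∈ʳ (there p) = there (before-∈ʳ p)

unique-∉ : Unique (x ∷ w) → ¬ x ∈ w
unique-∉ (x≢ ∷ _) x∈ = All.lookup x≢ x∈ refl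

unique-tail : Unique (x ∷ w) → Unique w
unique-tail (_ ∷ !w) = !w

unique-++⁻ʳ : ∀ u → Unique (u ++ v) → Unique v
unique-++⁻ʳ []      !v       = !v
unique-++⁻ʳ (_ ∷ u) (_ ∷ !w) = unique-++⁻ʳ u !w

unique-++⁻ˡ : ∀ u → Unique (u ++ v) → Unique u
unique-++⁻ˡ []      _         = []
unique-++⁻ˡ (_ ∷ u) (x≢ ∷ !w) = All.++⁻ˡ u x≢ ∷ unique-++⁻ˡ u !w

unique-resp-↭ : w ↭ w′ → Unique w → Unique w′
unique-resp-↭ p = Permutationₛ.Unique-resp-↭ (setoid Letter) (↭⇒↭ₛ p)

before-trans : Unique w → Transitive (Before w)
before-trans !w (here p)  (here q)  = contradiction p (unique-∉ !w)
before-trans !w (here p)  (there q) = here (before-∈ʳ q)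
before-trans !w (there p) (here q)  = contradiction (before-∈ʳ p) (unique-∉ !w)
before-trans !w (there p) (there q) = there (before-trans (unique-tail !w) p q)

before-irrefl : Unique w → ¬ Before w x x
before-irrefl !w (here p)  = unique-∉ !w p
before-irrefl !w (there p) = before-irrefl (unique-tail !w) p

before-asym : Unique w → Before w x y → ¬ Before w y x
before-asym !w p q = before-irrefl !w (before-trans !w p q)

before-total : x ∈ w → y ∈ w → x ≡ y ⊎ Before w x y ⊎ Before w y x
before-total (here refl) (here refl) = inj₁ refl
before-total (here refl) (there q)   = inj₂ (inj₁ (here q))
before-total (there p)   (here refl) = inj₂ (inj₂ (here p))
before-total (there p)   (there q)   = Sum.map₂ (Sum.map there there) (before-total p q)

before? : ∀ w x y → Dec (Before w x y)
before? []      x y = no λ ()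
before? (z ∷ w) x y with z ≟ x ×-dec any? (y ≟_) w | before? w x y
... | yes (refl , p) | _     = yes (here p)
... | no _           | yes p = yes (there p)
... | no ¬p          | no ¬q = no λ { (here p) → ¬p (refl , p) ; (there q) → ¬q q }

before-++ˡ : ∀ u → x ∈ u → y ∈ v → Before (u ++ v) x y
before-++ˡ (_ ∷ u) (here refl) y∈ = here (∈-++⁺ʳ u y∈)
before-++ˡ (_ ∷ u) (there x∈)  y∈ = there (before-++ˡ u x∈ y∈)

before-++ʳ : ∀ u → Before v x y → Before (u ++ v) x y
before-++ʳ []      p = p
before-++ʳ (_ ∷ u) p = there (before-++ʳ u p)

∈-prefix : ∀ u → Unique (u ++ x ∷ v) → Before (u ++ x ∷ v) c x → c ∈ u
∈-prefix []      !w (here p)  = contradiction p (unique-∉ !w)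
∈-prefix []      !w (there p) = contradiction (before-∈ʳ p) (unique-∉ !w)
∈-prefix (_ ∷ u) !w (here p)  = here refl
∈-prefix (_ ∷ u) !w (there p) = there (∈-prefix u (unique-tail !w) p)

∈-suffix : ∀ u → Unique (u ++ x ∷ v) → Before (u ++ x ∷ v) x b → b ∈ v
∈-suffix []      !w (here p)  = p
∈-suffix []      !w (there p) = contradiction (before-∈ˡ p) (unique-∉ !w)
∈-suffix (_ ∷ u) !w (here p)  = contradiction (∈-++⁺ʳ u (here refl)) (unique-∉ !w)
∈-suffix (_ ∷ u) !w (there p) = ∈-suffix u (unique-tail !w) p

before-split : Before w x y → ∃ λ u → ∃₂ λ m v → w ≡ u ++ x ∷ m ++ y ∷ v
before-split (here p) with m , v , refl ← ∈-∃++ p = [] , m , v , refl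
before-split (there p) with u , m , v , refl ← before-split p = _ ∷ u , m , v , refl

-- Together with `first`, this serves to pick an outermost bounding letter, beyond which no bounding
-- letter remains.
last : {P : Pred Letter Level.zero} → Decidable P → Unique w → Any P w →
       ∃ λ x → x ∈ w × P x × (∀ {y} → P y → ¬ Before w x y)
last {x ∷ w} P? !w h with any? P? w
... | yes h′ with y , y∈ , Py , max ← last P? (unique-tail !w) h′ =
  y , there y∈ , Py , λ where
    Pz (here _)  → unique-∉ !w y∈
    Pz (there p) → max Pz p
last P? !w (here Px)  | no ¬h = _ , here refl , Px , λ where
  Py (here y∈) → ¬h (lose y∈ Py)
  Py (there p) → ¬h (lose (before-∈ʳ p) Py)
last P? !w (there h) | no ¬h = contradiction h ¬h

first : {P : Pred Letter Level.zero} → Decidable P → Unique w → Any P w →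
        ∃ λ x → x ∈ w × P x × (∀ {y} → P y → ¬ Before w y x)
first {x ∷ w} P? !w h with P? x
... | yes Px = x , here refl , Px , λ where
  Py (here x∈) → unique-∉ !w x∈
  Py (there p) → unique-∉ !w (before-∈ʳ p)
first P? !w (here Px) | no ¬Px = contradiction Px ¬Px
first P? !w (there h) | no ¬Px with y , y∈ , Py , min ← first P? (unique-tail !w) h =
  y , there y∈ , Py , λ where
    Pz (here _)  → ¬Px Pz
    Pz (there p) → min Pz p

-- Exchanges of adjacent letters

data AdjacentSwap (R : Rel Letter Level.zero) : Rel Word Level.zero where
  swap : ∀ u v → R x y → AdjacentSwap R (u ++ x ∷ y ∷ v) (u ++ y ∷ x ∷ v)

-- Since `Between` is symmetric in its ends, one constructor covers both Baxter relations in both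
-- directions, with the surrounding context absorbed in `u` and `v`.
data BaxterSwap : Rel Word Level.zero where
  swap : ∀ u v → Any (λ c → Between x c y) u → Any (λ b → Between x b y) v →
         BaxterSwap (u ++ x ∷ y ∷ v) (u ++ y ∷ x ∷ v)

swap-↭ : ∀ u → u ++ x ∷ y ∷ v ↭ u ++ y ∷ x ∷ v
swap-↭ u = ++⁺ˡ u (swap _ _ ↭-refl)

baxterSwaps-↭ : Star BaxterSwap w w′ → w ↭ w′
baxterSwaps-↭ = Star.fold _↭_ (λ { (swap u v _ _) → ↭-trans (swap-↭ u) }) ↭-refl

baxterSwap-sym : BaxterSwap w w′ → BaxterSwap w′ w
baxterSwap-sym (swap u v p q) = swap u v (Any.map between-sym p) (Any.map between-sym q)

before-swap : ∀ u → Before (u ++ a ∷ d ∷ v) x y →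
              Before (u ++ d ∷ a ∷ v) x y ⊎ (x ≡ a × y ≡ d)
before-swap []      (here (here refl)) = inj₂ (refl , refl)
before-swap []      (here (there p))   = inj₁ (there (here p))
before-swap []      (there (here p))   = inj₁ (here (there p))
before-swap []      (there (there p))  = inj₁ (there (there p))
before-swap (_ ∷ u) (here p)           = inj₁ (here (∈-resp-↭ (swap-↭ u) p))
before-swap (_ ∷ u) (there p)          = Sum.map₁ there (before-swap u p)

-- The Baxter congruence and Baxter swaps

-- The two bounding letters `s` and `t` delimit a factor to which a Baxter relation applies;
-- `++-cong` restores the rest of the word.
BaxterSwap⇒≡B : BaxterSwap w w′ → w ≡B w′
BaxterSwap⇒≡B (swap {x} {y} u v p q)
  with s , s∈ , Bs ← find p | t , t∈ , Bt ← find q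
  with u₁ , u₂ , refl ← ∈-∃++ s∈ | v₁ , v₂ , refl ← ∈-∃++ t∈ =
  subst₂ _≡B_ (assoc x y) (assoc y x)
    (++-cong (refl {u₁}) (++-cong (core Bs Bt) (refl {v₂})))
  where
  assoc : ∀ x y → u₁ ++ (s ∷ u₂ ++ x ∷ y ∷ v₁ ++ t ∷ []) ++ v₂
                ≡ (u₁ ++ s ∷ u₂) ++ x ∷ y ∷ v₁ ++ t ∷ v₂
  assoc x y = ≡.trans
    (cong (λ r → u₁ ++ s ∷ r)
      (≡.trans (++-assoc u₂ _ v₂) (cong (λ r → u₂ ++ x ∷ y ∷ r) (++-assoc v₁ _ v₂))))
    (≡.sym (++-assoc u₁ (s ∷ u₂) _))

  ascending : ∀ {x y} → x < s → s < y → x < t → t < y →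
              s ∷ u₂ ++ x ∷ y ∷ v₁ ++ t ∷ [] ≡B s ∷ u₂ ++ y ∷ x ∷ v₁ ++ t ∷ []
  -- The relative order of the two bounding letters decides which Baxter relation is used.
  ascending x<s s<y x<t t<y with s ≤? t
  ... | yes s≤t = sym (budavc u₂ v₁ x<s s≤t t<y)
  ... | no s≰t  = cuadvb u₂ v₁ (ℕ.<⇒≤ x<t) (ℕ.≰⇒> s≰t) (ℕ.<⇒≤ s<y)

  core : Between x s y → Between x t y →
         s ∷ u₂ ++ x ∷ y ∷ v₁ ++ t ∷ [] ≡B s ∷ u₂ ++ y ∷ x ∷ v₁ ++ t ∷ []
  core (inj₁ (p , q)) (inj₁ (p′ , q′)) = ascending p q p′ q′
  core (inj₂ (p , q)) (inj₂ (p′ , q′)) = sym (ascending p q p′ q′)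
  core (inj₁ (p , q)) (inj₂ (p′ , q′)) =
    contradiction (ℕ.<-trans p q) (ℕ.<-asym (ℕ.<-trans p′ q′))
  core (inj₂ (p , q)) (inj₁ (p′ , q′)) =
    contradiction (ℕ.<-trans p q) (ℕ.<-asym (ℕ.<-trans p′ q′))

BaxterSwaps⇒≡B : Star BaxterSwap w w′ → w ≡B w′
BaxterSwaps⇒≡B = Star.fold _≡B_ (λ s p → trans (BaxterSwap⇒≡B s) p) refl

≡B⇒↭ : w ≡B w′ → w ↭ w′
≡B⇒↭ refl                   = ↭-refl
≡B⇒↭ (sym p)                = ↭-sym (≡B⇒↭ p)
≡B⇒↭ (trans p q)            = ↭-trans (≡B⇒↭ p) (≡B⇒↭ q)
≡B⇒↭ (++-cong p q)          = ++⁺ (≡B⇒↭ p) (≡B⇒↭ q)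
≡B⇒↭ (cuadvb u v {c = c} _ _ _) = swap-↭ (c ∷ u)
≡B⇒↭ (budavc u v {b = b} _ _ _) = swap-↭ (b ∷ u)

baxterSwap-++ˡ : ∀ p → BaxterSwap w w′ → BaxterSwap (p ++ w) (p ++ w′)
baxterSwap-++ˡ p (swap {x} {y} u v r s) =
  subst₂ BaxterSwap (++-assoc p u _) (++-assoc p u _) (swap (p ++ u) v (Any.++⁺ʳ p r) s)

baxterSwap-++ʳ : ∀ q → BaxterSwap w w′ → BaxterSwap (w ++ q) (w′ ++ q)
baxterSwap-++ʳ q (swap {x} {y} u v r s) =
  subst₂ BaxterSwap (≡.sym (++-assoc u _ q)) (≡.sym (++-assoc u _ q))
    (swap u (v ++ q) r (Any.++⁺ˡ s))

-- Without repetitions, the weak inequalities of the Baxter relations are strict.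
≡B⇒BaxterSwaps : w ≡B w′ → Unique w → Star BaxterSwap w w′
≡B⇒BaxterSwaps refl        !w = ε
≡B⇒BaxterSwaps (sym p)     !w =
  Star.reverse baxterSwap-sym (≡B⇒BaxterSwaps p (unique-resp-↭ (↭-sym (≡B⇒↭ p)) !w))
≡B⇒BaxterSwaps (trans p q) !w =
  ≡B⇒BaxterSwaps p !w ◅◅ ≡B⇒BaxterSwaps q (unique-resp-↭ (≡B⇒↭ p) !w)
≡B⇒BaxterSwaps (++-cong {x} {x′} {y} p q) !w =
  Star.gmap (_++ y) (baxterSwap-++ʳ y) (≡B⇒BaxterSwaps p (unique-++⁻ˡ x !w)) ◅◅
  Star.gmap (x′ ++_) (baxterSwap-++ˡ x′) (≡B⇒BaxterSwaps q (unique-++⁻ʳ x !w))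
≡B⇒BaxterSwaps (cuadvb u v {a} {b} {c} {d} a≤b b<c c≤d) !w@(c≢ ∷ _) =
  swap (c ∷ u) (v ++ b ∷ [])
    (here (inj₁ (ℕ.≤-<-trans a≤b b<c , c<d)))
    (Any.++⁺ʳ v (here (inj₁ (a<b , ℕ.<-≤-trans b<c c≤d)))) ◅ ε
  where
  c<d = ℕ.≤∧≢⇒< c≤d (All.lookup c≢ (∈-++⁺ʳ u (there (here refl))))
  a<b = ℕ.≤∧≢⇒< a≤b λ { refl →
    unique-∉ (unique-++⁻ʳ (c ∷ u) !w) (there (∈-++⁺ʳ v (here refl))) }
≡B⇒BaxterSwaps (budavc u v {a} {b} {c} {d} a<b b≤c c<d) !w =
  swap (b ∷ u) (v ++ c ∷ [])
    (here (inj₂ (a<b , ℕ.≤-<-trans b≤c c<d)))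
    (Any.++⁺ʳ v (here (inj₂ (ℕ.<-≤-trans a<b b≤c , c<d)))) ◅ ε

-- Straddled pairs

-- Used with R the order of the letters in a word, and with its converse.
Bounded : Rel Letter Level.zero → Letter → Letter → Set
Bounded R x y = ∃ λ b → Between x b y × R x b × R y b

Straddled : Word → Letter → Letter → Set
Straddled w x y = Bounded (flip (Before w)) x y × Bounded (Before w) x y

-- If q is the only bound of x and y that is lost, because x = p, then a letter
-- that bounds p and q also bounds x and y.
bounded-mono : {R R′ : Rel Letter Level.zero} {p q t : Letter} → Transitive R′ →
               (∀ {x y} → R x y → R′ x y ⊎ (x ≡ p × y ≡ q)) →
               Between p t q → R′ p t → R′ q t →
               Bounded R x y → Bounded R′ x y
bounded-mono R′-trans R⇒R′ B pt qt (b , Bb , xb , yb) with R⇒R′ xb | R⇒R′ yb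
... | inj₁ xb′           | inj₁ yb′           = b , Bb , xb′ , yb′
... | inj₂ (refl , refl) | inj₁ yb′           =
  _ , between-narrowˡ Bb B , pt , R′-trans yb′ qt
... | inj₁ xb′           | inj₂ (refl , refl) =
  _ , between-narrowʳ Bb (between-sym B) , R′-trans xb′ qt , pt
... | inj₂ (refl , refl) | inj₂ (refl , _)    = contradiction Bb ¬between-same

-- A bound lost in the exchange is replaced by `s` on the left or by `t` on the right. Left bounds
-- use the converse order, in which the lost pair reads `d`, `a`.
straddled-swap : BaxterSwap w w′ → Unique w′ → Straddled w x y → Straddled w′ x y
straddled-swap (swap {a} {d} u v p q) !w′ (l , r)
  with s , s∈ , Bs ← find p | t , t∈ , Bt ← find q =
    bounded-mono (flip (before-trans !w′))
      (Sum.map₂ (λ { (e , e′) → e′ , e }) ∘ before-swap u)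
      (between-sym Bs) (before-++ˡ u s∈ (here refl)) (before-++ˡ u s∈ (there (here refl))) l
  , bounded-mono (before-trans !w′) (before-swap u) Bt
      (before-++ʳ u (there (here t∈))) (before-++ʳ u (here (there t∈))) r

baxterSwap-straddled : ∀ u → Any (λ c → Between x c y) u → Any (λ b → Between x b y) v →
                       Straddled (u ++ x ∷ y ∷ v) x y
baxterSwap-straddled u p q with s , s∈ , Bs ← find p | t , t∈ , Bt ← find q =
    (s , Bs , before-++ˡ u s∈ (here refl) , before-++ˡ u s∈ (there (here refl)))
  , (t , Bt , before-++ʳ u (here (there t∈)) , before-++ʳ u (there (here t∈)))

-- Characterisation of a class by its unstraddled pairs

Close : Word → Word → Set
Close σ τ = ∀ {x y} → Before σ x y → Before τ y x → Straddled σ x y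

-- A pair reversed along the chain either is the one exchanged first, which is straddled by
-- definition, or is straddled after that exchange by induction, hence also before it.
BaxterSwaps⇒Close : Star BaxterSwap w w′ → Unique w → Close w w′
BaxterSwaps⇒Close ε !w p q = contradiction q (before-asym !w p)
BaxterSwaps⇒Close (s@(swap u v l r) ◅ ss) !w p q with before-swap u p
... | inj₁ p′            = straddled-swap (baxterSwap-sym s) !w
      (BaxterSwaps⇒Close ss (unique-resp-↭ (swap-↭ u) !w) p′ q)
... | inj₂ (refl , refl) = baxterSwap-straddled u l r

bubble : ∀ {σ s} u v → All (Before σ s) u →
         Star (AdjacentSwap (flip (Before σ))) (u ++ s ∷ v) (s ∷ u ++ v)
bubble []      v []       = ε
bubble (x ∷ u) v (p ∷ ps) =
  Star.gmap (x ∷_) (λ { (swap u v r) → swap (x ∷ u) v r }) (bubble u v ps) ◅◅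
  swap [] (u ++ v) p ◅ ε

-- The first letter of `σ` is moved to the front, past letters that all follow it in `σ`; the
-- remainder is sorted recursively.
bubbleSort : ∀ σ {τ} → τ ↭ σ → Star (AdjacentSwap (flip (Before σ))) τ σ
bubbleSort [] p with refl ← ↭-empty-inv p = ε
bubbleSort (s ∷ σ) {τ} p
  with u , v , refl ← ∈-∃++ (∈-resp-↭ (↭-sym p) (here refl)) =
  bubble u v (All.tabulate λ y∈ → here (∈-resp-↭ u++v↭σ (Any.++⁺ˡ y∈))) ◅◅
  Star.gmap (s ∷_) (λ { (swap u v r) → swap (s ∷ u) v (there r) }) (bubbleSort σ u++v↭σ)
  where
  u++v↭σ : u ++ v ↭ σ
  u++v↭σ = drop-mid u [] p

module _ {σ τ : Word} (!σ : Unique σ) (τ↭σ : τ ↭ σ) (close : Close σ τ) where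

  unstraddled-kept : Before σ x y → ¬ Straddled σ x y → Before τ x y
  unstraddled-kept p ¬s with before-total (∈-resp-↭ (↭-sym τ↭σ) (before-∈ˡ p))
                              (∈-resp-↭ (↭-sym τ↭σ) (before-∈ʳ p))
  ... | inj₁ refl     = contradiction p (before-irrefl !σ)
  ... | inj₂ (inj₁ q) = q
  ... | inj₂ (inj₂ q) = contradiction (close p q) ¬s

  -- If b is the last letter of σ between x and y, then x and b are not
  -- straddled, so x precedes b also in τ.
  bounded-transfer : Straddled σ x y → Bounded (Before τ) x y
  bounded-transfer {x} {y} (_ , t , Bt , xt , yt)
    with b , b∈ , (B , xb , yb) , max ← last
           (λ b → between? x b y ×-dec before? σ x b ×-dec before? σ y b)
           !σ (lose (before-∈ʳ xt) (Bt , xt , yt)) =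
    b , B
    , unstraddled-kept xb (λ { (_ , b′ , B′ , xb′ , bb′) →
        max (between-narrowˡ B B′ , xb′ , before-trans !σ yb bb′) bb′ })
    , unstraddled-kept yb (λ { (_ , b′ , B′ , yb′ , bb′) →
        max (between-narrowʳ B (between-sym B′) , before-trans !σ xb bb′ , yb′) bb′ })

  -- Mirror image of `bounded-transfer`, with the first bounding letter in place of the last.
  bounded-transferᵒ : Straddled σ x y → Bounded (flip (Before τ)) x y
  bounded-transferᵒ {x} {y} ((t , Bt , tx , ty) , _)
    with b , b∈ , (B , bx , by) , min ← first
           (λ b → between? x b y ×-dec before? σ b x ×-dec before? σ b y)
           !σ (lose (before-∈ˡ tx) (Bt , tx , ty)) =
    b , B
    , unstraddled-kept bx (λ { ((b′ , B′ , b′b , b′x) , _) →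
        min (between-narrowˡ B (between-sym B′) , b′x , before-trans !σ b′b by) b′b })
    , unstraddled-kept by (λ { ((b′ , B′ , b′b , b′y) , _) →
        min (between-narrowʳ B B′ , before-trans !σ b′b bx , b′y) b′b })

-- Each exchange of the bubble sort concerns a pair on which `τ` and `σ` disagree. Closeness makes
-- it straddled in `σ`, and the transfer lemmas provide bounds in `τ`, so the exchange is a Baxter
-- swap.
Close⇒BaxterSwaps : ∀ {σ τ} → Unique σ → τ ↭ σ → Close σ τ → Star BaxterSwap τ σ
Close⇒BaxterSwaps {σ} !σ τ↭σ close = go (bubbleSort σ τ↭σ) τ↭σ close
  where
  go : ∀ {τ} → Star (AdjacentSwap (flip (Before σ))) τ σ → τ ↭ σ → Close σ τ → Star BaxterSwap τ σ
  go ε τ↭σ close = ε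
  go {τ} (swap {x} {y} u v yx ◅ ss) τ↭σ close
    with yx-straddled ← close yx (before-++ʳ u (here (here refl)))
    with !τ ← unique-resp-↭ (↭-sym τ↭σ) !σ
    with s , Bs , _ , sx ← bounded-transferᵒ !σ τ↭σ close yx-straddled
       | t , Bt , yt , xt ← bounded-transfer !σ τ↭σ close yx-straddled =
    swap u v
      (lose (∈-prefix u !τ sx) (between-sym Bs))
      (lose (tail (∈-suffix u !τ xt)) (between-sym Bt))
    ◅ go ss (↭-trans (↭-sym (swap-↭ u)) τ↭σ) close′
    where
    tail : t ∈ y ∷ v → t ∈ v
    tail (here refl) = contradiction yt (before-irrefl !τ)
    tail (there t∈)  = t∈

    -- The only new order created is that of `y` before `x`, which agrees with `σ`.
    close′ : Close σ (u ++ y ∷ x ∷ v)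
    close′ p q with before-swap u q
    ... | inj₁ q′            = close p q′
    ... | inj₂ (refl , refl) = contradiction p (before-asym !σ yx)

-- Extremal elements of a class

-- Stated for any strict total order inducing the same betweenness: `<` yields greatest elements and
-- `>` least ones.
module Extremal (_◁_ : Rel Letter Level.zero)
                (isStrictTotalOrder : IsStrictTotalOrder _≡_ _◁_)
                (between⁺ : ∀ {x b y} → x ◁ b → b ◁ y → Between x b y)
                (between⁻ : ∀ {x b y} → x ◁ y → Between x b y → x ◁ b × b ◁ y) where

  open IsStrictTotalOrder isStrictTotalOrder using (compare)
    renaming (_<?_ to _◁?_; trans to ◁-trans; asym to ◁-asym; irrefl to ◁-irrefl)

  -- These are the normal forms for the rewriting of straddled `◁`-ascents by Baxter swaps.
  Irreducible : Word → Set
  Irreducible w = ∀ u v {x y} → w ≡ u ++ x ∷ y ∷ v → x ◁ y →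
                  Any (λ c → Between x c y) u → ¬ Any (λ b → Between x b y) v

  -- The prefix `u` has already been scanned and supplies the possible left bounds.
  reduce? : ∀ u w →
    (∃ λ w′ → BaxterSwap (u ++ w) w′ × AdjacentSwap _◁_ (u ++ w) w′) ⊎
    (∀ u′ v {x y} → w ≡ u′ ++ x ∷ y ∷ v → x ◁ y →
     Any (λ c → Between x c y) (u ++ u′) → ¬ Any (λ b → Between x b y) v)
  reduce? u [] = inj₂ λ { [] _ () ; (_ ∷ _) _ () }
  reduce? u (x ∷ []) = inj₂ λ { [] _ () ; (_ ∷ []) _ () ; (_ ∷ _ ∷ _) _ () }
  reduce? u (x ∷ y ∷ w)
    with x ◁? y ×-dec any? (λ c → between? x c y) u ×-dec any? (λ b → between? x b y) w
       | reduce? (u ∷ʳ x) (y ∷ w)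
  ... | yes (x◁y , p , q) | _ = inj₁ (_ , swap u w p q , swap u w x◁y)
  ... | no _ | inj₁ (w′ , s) = inj₁ (w′ ,
          subst (λ r → BaxterSwap r w′ × AdjacentSwap _◁_ r w′) (∷ʳ-++ u x (y ∷ w)) s)
  ... | no ¬here | inj₂ ¬there = inj₂ λ where
          []       v refl x◁y p q → ¬here (x◁y , subst (Any _) (++-identityʳ u) p , q)
          (_ ∷ u′) v e x◁y p q → case ∷-injective e of λ where
            (refl , e′) →
              ¬there u′ v e′ x◁y (subst (Any _) (≡.sym (∷ʳ-++ u x u′)) p) q

  -- The termination measure of the rewriting. For `>` these are the usual inversions, for `<` the
  -- non-inversions.
  inversions : Word → ℕ
  inversions []      = 0
  inversions (x ∷ w) = length (filter (x ◁?_) w) + inversions w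

  inversions-swap : AdjacentSwap _◁_ w w′ → inversions w′ < inversions w
  -- Only the exchanged pair stops being counted; the other contributions are the same sum
  -- reordered.
  inversions-swap (swap {x} {y} [] v x◁y)
    rewrite filter-accept (x ◁?_) {xs = v} x◁y
          | filter-reject (y ◁?_) {xs = v} (◁-asym x◁y) = s≤s (ℕ.≤-reflexive (begin
      Y + (X + inversions v)  ≡⟨ ℕ.+-assoc Y X _ ⟨
      Y + X + inversions v    ≡⟨ cong (_+ inversions v) (ℕ.+-comm Y X) ⟩
      X + Y + inversions v    ≡⟨ ℕ.+-assoc X Y _ ⟩
      X + (Y + inversions v)  ∎))
    where
    open ≡.≡-Reasoning
    X = length (filter (x ◁?_) v)
    Y = length (filter (y ◁?_) v)
  inversions-swap (swap (z ∷ u) v x◁y) =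
    ℕ.+-mono-≤-< (ℕ.≤-reflexive (↭-length (filter-↭ (z ◁?_) (↭-sym (swap-↭ u)))))
                 (inversions-swap (swap u v x◁y))

  reduce : ∀ w → ∃ λ w′ → Star BaxterSwap w w′ × Irreducible w′
  reduce w = go w (<-wellFounded (inversions w))
    where
    go : ∀ w → Acc _<_ (inversions w) → ∃ λ w′ → Star BaxterSwap w w′ × Irreducible w′
    go w (acc rec) with reduce? [] w
    ... | inj₂ irr = w , ε , irr
    ... | inj₁ (w₁ , s , s◁) with w′ , ss , irr ← go w₁ (rec (inversions-swap s◁)) =
      w′ , s ◅ ss , irr

  _⊴_ : Rel Letter Level.zero
  x ⊴ y = x ≡ y ⊎ x ◁ y

  ⊴-◁-trans : x ⊴ y → y ◁ z → x ◁ z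
  ⊴-◁-trans (inj₁ refl) q = q
  ⊴-◁-trans (inj₂ p)    q = ◁-trans p q

  ◁-⊴-trans : x ◁ y → y ⊴ z → x ◁ z
  ◁-⊴-trans p (inj₁ refl) = p
  ◁-⊴-trans p (inj₂ q)    = ◁-trans p q

  between-widen : a ◁ d → x ⊴ a → d ⊴ y → Between a b d → Between x b y
  between-widen a◁d x⊴a d⊴y B with p , q ← between⁻ a◁d B =
    between⁺ (⊴-◁-trans x⊴a p) (◁-⊴-trans q d⊴y)

  -- Scan from `a` to `d`, with `f` the current letter. Values strictly between `a` and `d` being
  -- absent, the first letter beyond `a` is at least `d` for `◁`. It forms with its predecessor an
  -- ascent that encloses both values and inherits their bounds.
  irreducible-crossing : ∀ u f m {v} → Irreducible (u ++ f ∷ m ++ d ∷ v) →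
    a ◁ d → f ⊴ a → All (λ e → ¬ (a ◁ e × e ◁ d)) m →
    Any (λ c → Between a c d) u → ¬ Any (λ b → Between a b d) v
  irreducible-crossing u f [] irr a◁d f⊴a [] p q =
    irr u _ refl (⊴-◁-trans f⊴a a◁d)
      (Any.map (between-widen a◁d f⊴a (inj₁ refl)) p)
      (Any.map (between-widen a◁d f⊴a (inj₁ refl)) q)
  irreducible-crossing {d} {a} u f (e ∷ m) {v} irr a◁d f⊴a (¬e ∷ ¬m) p q with compare a e
  ... | tri≈ _ refl _ = irreducible-crossing (u ∷ʳ f) e m
        (subst Irreducible (≡.sym (∷ʳ-++ u f _)) irr) a◁d (inj₁ refl) ¬m (Any.++⁺ˡ p) q
  ... | tri> _ _ e◁a = irreducible-crossing (u ∷ʳ f) e m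
        (subst Irreducible (≡.sym (∷ʳ-++ u f _)) irr) a◁d (inj₂ e◁a) ¬m (Any.++⁺ˡ p) q
  ... | tri< a◁e _ _ = irr u (m ++ d ∷ v) refl (⊴-◁-trans f⊴a a◁e)
        (Any.map (between-widen a◁d f⊴a d⊴e) p)
        (Any.map (between-widen a◁d f⊴a d⊴e) (Any.++⁺ʳ m (there q)))
    where
    d⊴e : d ⊴ e
    d⊴e with compare d e
    ... | tri< d◁e _ _  = inj₂ d◁e
    ... | tri≈ _ refl _ = inj₁ refl
    ... | tri> _ _ e◁d  = contradiction (a◁e , e◁d) ¬e

  -- Minimality of the distance becomes an induction on `n`, a strict bound on the number of letters
  -- standing between `a` and `d`.
  irreducible-extremal : ∀ {σ τ} → Unique σ → σ ↭ τ → Irreducible σ → Close σ τ →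
                         a ◁ d → Before σ a d → Before τ a d
  irreducible-extremal {σ = σ} {τ} !σ σ↭τ irr close a◁d ad
    with u , m , v , e ← before-split ad = go (suc (length m)) u m v ℕ.≤-refl e a◁d
    where
    !τ = unique-resp-↭ σ↭τ !σ

    go : ∀ n u m v → length m < n → σ ≡ u ++ a ∷ m ++ d ∷ v → a ◁ d → Before τ a d
    go {a} {d} (suc n) u m v (s≤s |m|≤n) refl a◁d
      with any? (λ e → a ◁? e ×-dec e ◁? d) m
    -- An intermediate value `e` splits the pair into two closer ones, settled by induction and
    -- joined by transitivity.
    ... | yes h with e , e∈ , a◁e , e◁d ← find h with m₁ , m₂ , refl ← ∈-∃++ e∈ =
      before-trans !τ
        (go n u m₁ (m₂ ++ d ∷ v) (ℕ.≤-trans (ℕ.m≤m+n _ _) |m₁|+|m₂|<n)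
            (cong (λ r → u ++ a ∷ r) (++-assoc m₁ _ _)) a◁e)
        (go n (u ++ a ∷ m₁) m₂ v (ℕ.≤-trans (s≤s (ℕ.m≤n+m _ _)) |m₁|+|m₂|<n)
            (≡.trans (cong (λ r → u ++ a ∷ r) (++-assoc m₁ _ _)) (≡.sym (++-assoc u _ _))) e◁d)
      where
      |m₁|+|m₂|<n : suc (length m₁ + length m₂) ≤ n
      |m₁|+|m₂|<n = subst (_≤ n)
        (≡.trans (length-++ m₁) (ℕ.+-suc (length m₁) (length m₂))) |m|≤n
    ... | no ¬h
      with before-total (∈-resp-↭ σ↭τ (∈-++⁺ʳ u (here refl)))
                        (∈-resp-↭ σ↭τ (∈-++⁺ʳ u (there (∈-++⁺ʳ m (here refl)))))
    ...   | inj₁ refl      = contradiction a◁d (◁-irrefl refl)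
    ...   | inj₂ (inj₁ ad) = ad
    ...   | inj₂ (inj₂ da)
      with (s , Bs , sa , _) , (t , Bt , _ , dt) ←
           close (before-++ʳ u (here (∈-++⁺ʳ m (here refl)))) da =
      contradiction
        (lose (∈-suffix (u ++ a ∷ m) (subst Unique assoc !σ)
                        (subst (λ r → Before r d t) assoc dt)) Bt)
        (irreducible-crossing u a m irr a◁d (inj₁ refl) (¬Any⇒All¬ m ¬h)
          (lose (∈-prefix u !σ sa) Bs))
      where
      assoc : u ++ a ∷ m ++ d ∷ v ≡ (u ++ a ∷ m) ++ d ∷ v
      assoc = ≡.sym (++-assoc u (a ∷ m) (d ∷ v))

-- The two orientations of the alphabet

<-between⁻ : x < y → Between x b y → x < b × b < y
<-between⁻ _ (inj₁ B)       = B
<-between⁻ p (inj₂ (q , r)) = contradiction (ℕ.<-trans q r) (ℕ.<-asym p)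

>-between⁻ : x > y → Between x b y → x > b × b > y
>-between⁻ p (inj₁ (q , r)) = contradiction (ℕ.<-trans q r) (ℕ.<-asym p)
>-between⁻ _ (inj₂ (q , r)) = r , q

module Greatest = Extremal _<_ ℕ.<-isStrictTotalOrder
  (λ p q → inj₁ (p , q)) <-between⁻

module Least = Extremal _>_ (Flip.isStrictTotalOrder ℕ.<-isStrictTotalOrder)
  (λ p q → inj₂ (q , p)) >-between⁻

-- The permutohedron order as inclusion of inversion sets

_⊑_ : Rel Word Level.zero
σ ⊑ τ = ∀ {a d} → a < d → Before σ d a → Before τ d a

-- Inversions of `x` persist in `z`, so a pair ordered differently in `z` is a new inversion; it is
-- then an inversion of `y` too, and closeness of `y` applies.
⊑-interval-close : ∀ {x y z} → Unique x → Unique z → y ↭ z →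
                   Close x y → x ⊑ z → z ⊑ y → Close x z
⊑-interval-close !x !z y↭z close x⊑z z⊑y {i} {j} ij ji with ℕ.<-cmp i j
... | tri< i<j _ _  = close ij (z⊑y i<j ji)
... | tri≈ _ refl _ = contradiction ij (before-irrefl !x)
... | tri> _ _ j<i  = contradiction (x⊑z j<i ij) (before-asym !z ji)

module _ {n : ℕ} where

  -- The proof carried by `σ` is irrelevant; decidability of uniqueness recovers a usable one.
  𝔖-unique : (σ : 𝔖 n) → Unique (value σ)
  𝔖-unique (w , [ p ]) = recompute (unique? w) (IsPermutation.noRepetition p)

  isPermutation-resp-↭ : w ↭ w′ → IsPermutation n w → IsPermutation n w′
  isPermutation-resp-↭ p record { length≡n = l ; noRepetition = r ; firstLetters = f } = record
    { length≡n     = ≡.trans (≡.sym (↭-length p)) l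
    ; noRepetition = unique-resp-↭ p r
    ; firstLetters = All-resp-↭ p f
    }

  ≤P⇒↭ : {σ τ : 𝔖 n} → σ ≤P τ → value σ ↭ value τ
  ≤P⇒↭ ε                            = ↭-refl
  ≤P⇒↭ (swap u v _ refl refl ◅ ss) = ↭-trans (swap-↭ u) (≤P⇒↭ ss)

  ⋖⇒⊑ : {σ τ : 𝔖 n} → σ ⋖ τ → value σ ⊑ value τ
  ⋖⇒⊑ (swap u v a<b refl refl) x<y p with before-swap u p
  ... | inj₁ q             = q
  ... | inj₂ (refl , refl) = contradiction x<y (ℕ.<-asym a<b)

  ≤P⇒⊑ : {σ τ : 𝔖 n} → σ ≤P τ → value σ ⊑ value τ
  ≤P⇒⊑ ε        _   p = p
  ≤P⇒⊑ (s ◅ ss) x<y p = ≤P⇒⊑ ss x<y (⋖⇒⊑ s x<y p)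

  ascents⇒≤P : .(p : IsPermutation n w) .(q : IsPermutation n w′) →
               Star (AdjacentSwap _<_) w w′ → (w , [ p ]) ≤P (w′ , [ q ])
  ascents⇒≤P p q ε = ε
  ascents⇒≤P p q (swap u v a<b ◅ ss) =
    swap u v a<b refl refl ◅ ascents⇒≤P (isPermutation-resp-↭ (swap-↭ u) p) q ss

  -- Bubble sort towards `τ` only exchanges pairs that disagree with `τ`. Such a pair is an ascent,
  -- because a descent would be an inversion of `τ`; after the exchange the inclusion still holds.
  ⊑⇒≤P : (σ τ : 𝔖 n) → value σ ↭ value τ → value σ ⊑ value τ → σ ≤P τ
  ⊑⇒≤P (w , [ p ]) τ@(w′ , [ q ]) w↭w′ w⊑w′ =
    ascents⇒≤P p q (ascents (bubbleSort w′ w↭w′) w⊑w′)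
    where
    !w′ = 𝔖-unique τ

    ascents : ∀ {w} → Star (AdjacentSwap (flip (Before w′))) w w′ → w ⊑ w′ →
              Star (AdjacentSwap _<_) w w′
    ascents ε w⊑w′ = ε
    ascents (swap {x} {y} u v yx ◅ ss) w⊑w′ = swap u v x<y ◅ ascents ss λ a<d p →
      Sum.[ w⊑w′ a<d , (λ { (refl , refl) → yx }) ]′ (before-swap u p)
      where
      x<y : x < y
      x<y with ℕ.<-cmp x y
      ... | tri< x<y _ _  = x<y
      ... | tri≈ _ refl _ = contradiction yx (before-irrefl !w′)
      ... | tri> _ _ y<x  =
        contradiction (w⊑w′ y<x (before-++ʳ u (here (here refl)))) (before-asym !w′ yx)

-- Each class as an interval

proposition3p8 : (n : ℕ) (σ : 𝔖 n) → IsInterval _≤P_ (BaxterClass σ)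
proposition3p8 n σ@(w , [ p ])
  with x , σ→x , x-irr ← Least.reduce w | y , σ→y , y-irr ← Greatest.reduce w =
  ⊥ₚ , ⊤ₚ , inside , λ {z} (x≤z , z≤y) → convex {z} x≤z z≤y
  where
  !σ = 𝔖-unique σ
  ⊥ₚ ⊤ₚ : 𝔖 n
  ⊥ₚ = x , [ isPermutation-resp-↭ (baxterSwaps-↭ σ→x) p ]
  ⊤ₚ = y , [ isPermutation-resp-↭ (baxterSwaps-↭ σ→y) p ]
  !x = 𝔖-unique ⊥ₚ
  !y = 𝔖-unique ⊤ₚ
  x→σ = Star.reverse baxterSwap-sym σ→x
  y→σ = Star.reverse baxterSwap-sym σ→y

  inside : ∀ {z} → BaxterClass σ z → ⊥ₚ ≤P z × z ≤P ⊤ₚ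
  inside {z} σ≡z =
      ⊑⇒≤P ⊥ₚ z x↭z (Least.irreducible-extremal !x x↭z x-irr
        (BaxterSwaps⇒Close x→z !x))
    , ⊑⇒≤P z ⊤ₚ (↭-sym y↭z) z⊑y
    where
    σ→z = ≡B⇒BaxterSwaps σ≡z !σ
    x→z = x→σ ◅◅ σ→z
    y→z = y→σ ◅◅ σ→z
    x↭z = baxterSwaps-↭ x→z
    y↭z = baxterSwaps-↭ y→z

    -- Extremality of `y` says that its non-inversions persist in `z`; inclusion of inversions is
    -- the contrapositive.
    z⊑y : value z ⊑ y
    z⊑y a<d da with before-total (∈-resp-↭ (↭-sym y↭z) (before-∈ˡ da))
                                 (∈-resp-↭ (↭-sym y↭z) (before-∈ʳ da))
    ... | inj₁ refl      = contradiction a<d (ℕ.<-irrefl refl)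
    ... | inj₂ (inj₁ da′) = da′
    ... | inj₂ (inj₂ ad) = contradiction da (before-asym (𝔖-unique z)
          (Greatest.irreducible-extremal !y y↭z y-irr (BaxterSwaps⇒Close y→z !y) a<d ad))

  convex : ∀ {z} → ⊥ₚ ≤P z → z ≤P ⊤ₚ → BaxterClass σ z
  -- The upper end is close to the lower end `x`, hence so is `z`, which is therefore linked to `x`
  -- by Baxter swaps.
  convex {z} x≤z z≤y = BaxterSwaps⇒≡B (σ→x ◅◅ Star.reverse baxterSwap-sym
    (Close⇒BaxterSwaps !x (↭-sym (≤P⇒↭ x≤z))
      (⊑-interval-close !x (𝔖-unique z) (↭-sym (≤P⇒↭ z≤y))
        (BaxterSwaps⇒Close (x→σ ◅◅ σ→y) !x) (≤P⇒⊑ x≤z) (≤P⇒⊑ z≤y))))
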